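{- Let $T=(V,E)$ be a tree shape and $k$ a positive integer such that for every choice of root $u_0\in V$ there is a root-to-leaf path in $T$ containing at least $k$ turning points. Then any growth process for $T$ starting from a single node in the connectivity graph model requires at least $k-1$ time steps.
   Context: Shapes. Grid points are integer pairs $(x,y)$; two grid points are adjacent if they are at orthogonal (Manhattan) distance $1$. A shape $S=(V,E)$ is a finite connected graph whose nodes occupy distinct grid points and whose edges join only pairs of nodes occupying adjacent points; shapes are considered up to translation. Growth operations. One node, the anchor $u_0$, is stationary; other nodes move relative to it, and a tree is rooted at $u_0$. A growth operation on a node $u$ toward an adjacent grid point $p$ either (i) if $u$ has no edge to $p$, creates a new node $u'$ at $p$ with edge $uu'$; or (ii) if $p$ is occupied by a node $v$ with $uv\in E$, creates a new node $u'$ at $p$, replaces edge $uv$ by edges $uu',u'v$, and translates by one unit, along the axis of $uv$, the part of the tree hanging from whichever of $u,v$ is farther from $u_0$, away from the other endpoint. In one time step a set of operations is applied concurrently, each node receiving at most one operation and all operations having the same cardinal direction; the displacement of each node is the sum of the unit vectors contributed by the operations on its path to $u_0$. The set is collision-free if no two nodes collide during these motions or end at the same point. Growth processes (connectivity graph model). A growth process from an initial shape $S_0$ performs time steps $t=1,2,\dots$, each applying a collision-free set of growth operations to the current shape; no edges are deleted and no edges are created other than by the operations. It grows $S$ from $S_0$ in $t_f$ time steps if the shape obtained after step $t_f$ is $S$. A node $w$ of a path is a turning point of the path if it is an endpoint or its two path-neighbors $v_1,v_2$ satisfy $v_1w\perp wv_2$. -}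

module Defs where

open import Data.Nat using (ℕ; zero; suc; _≤_; _<_; _≥_)
open import Data.Nat as ℕ using ()
open import Data.Integer as ℤ using (ℤ; 0ℤ; 1ℤ; -1ℤ; ∣_∣)
open import Data.Rational as ℚ using (ℚ; 0ℚ; 1ℚ)
open import Data.Fin using (Fin)
open import Data.Fin.Subset using (Subset; _∈_)
open import Data.Fin.Subset.Properties using (_∈?_)
open import Data.List using (List; []; _∷_; _++_; length)
open import Data.List.Relation.Unary.All using (All)
open import Data.List.Relation.Unary.Unique.Propositional using (Unique)
open import Data.Product using (Σ; Σ-syntax; ∃; ∃-syntax; _×_; _,_; proj₁; proj₂)
open import Data.Product.Properties using (≡-dec)
open import Data.Sum using (_⊎_; inj₁; inj₂)
open import Function.Bundles using (_↔_; _⇔_; Inverse)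
open import Function.Definitions using (Injective)
open import Level using (0ℓ)
open import Relation.Binary using (Rel; Symmetric; Decidable)
open import Relation.Binary.Construct.Closure.ReflexiveTransitive using (Star; ε; _◅_)
open import Relation.Binary.PropositionalEquality using (_≡_)
open import Relation.Nullary using (¬_; yes; no)
open import Relation.Nullary.Decidable using (_×-dec_; _⊎-dec_)

Point : Set
Point = ℤ × ℤ

infixl 6 _⊞_ _⊟_
infix  4 _≟ₚ_ _⟂_

_⊞_ _⊟_ : Point → Point → Point
(x , y) ⊞ (x′ , y′) = (x ℤ.+ x′) , (y ℤ.+ y′)
(x , y) ⊟ (x′ , y′) = (x ℤ.- x′) , (y ℤ.- y′)

_≟ₚ_ : Decidable {A = Point} _≡_
_≟ₚ_ = ≡-dec ℤ._≟_ ℤ._≟_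

Adjacent : Rel Point 0ℓ
Adjacent (x , y) (x′ , y′) = ∣ x ℤ.- x′ ∣ ℕ.+ ∣ y ℤ.- y′ ∣ ≡ 1

_⟂_ : Rel Point 0ℓ
(x , y) ⟂ (x′ , y′) = x ℤ.* x′ ℤ.+ y ℤ.* y′ ≡ 0ℤ

data Direction : Set where
  north east south west : Direction

unit : Direction → Point
unit north = 0ℤ  , 1ℤ
unit east  = 1ℤ  , 0ℤ
unit south = 0ℤ  , -1ℤ
unit west  = -1ℤ , 0ℤ

record Shape : Set₁ where
  infix 4 _~_ _~?_
  field
    size : ℕ

  Node : Set
  Node = Fin size

  field
    pos           : Node → Point
    _~_           : Rel Node 0ℓ
    _~?_          : Decidable _~_
    ~-sym         : Symmetric _~_
    ~-adjacent    : ∀ {u v} → u ~ v → Adjacent (pos u) (pos v)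
    pos-injective : Injective _≡_ _≡_ pos
    nonempty      : 0 < size
    connected     : ∀ u v → Star _~_ u v

-- Shapes are identified up to translation (and renaming of nodes).
record _≅_ (S T : Shape) : Set where
  private
    module S = Shape S
    module T = Shape T
  field
    nodes↔      : S.Node ↔ T.Node
    translation : Point

  to : S.Node → T.Node
  to = Inverse.to nodes↔

  field
    pos-to : ∀ u → T.pos (to u) ≡ S.pos u ⊞ translation
    ~-to   : ∀ u v → (u S.~ v) ⇔ (to u T.~ to v)

module _ (S : Shape) where
  open Shape S

  Walk : Node → Node → Set
  Walk = Star _~_

  nodes : ∀ {u v} → Walk u v → List Node
  nodes {u} ε       = u ∷ []
  nodes {u} (_ ◅ p) = u ∷ nodes p

  Path : Node → Node → Set
  Path u v = Σ[ p ∈ Walk u v ] Unique (nodes p)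

  Cycle : Set
  Cycle = ∃[ u ] ∃[ v ] Σ[ p ∈ Path u v ] (length (nodes (proj₁ p)) ≥ 3 × v ~ u)

  IsTree : Set
  IsTree = ¬ Cycle

  -- Child r w v: with root r, w is the node preceding v on a path from r to v.
  Child : Node → Node → Node → Set
  Child r w v = Σ[ p ∈ Path r v ] ∃[ us ] nodes (proj₁ p) ≡ us ++ w ∷ v ∷ []

  -- A leaf of the tree rooted at r; the root is one only if it is the sole node.
  Leaf : Node → Node → Set
  Leaf r w = ∀ v → ¬ Child r w v

  data TurningPoint {u v} (p : Path u v) (w : Node) : Set where
    first : w ≡ u → TurningPoint p w
    last  : w ≡ v → TurningPoint p w
    bend  : ∀ us v₁ v₂ vs → nodes (proj₁ p) ≡ us ++ v₁ ∷ w ∷ v₂ ∷ vs →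
            (pos w ⊟ pos v₁) ⟂ (pos v₂ ⊟ pos w) → TurningPoint p w

  HasTurningPoints≥ : ∀ {u v} → ℕ → Path u v → Set
  HasTurningPoints≥ k p =
    ∃[ ws ] Unique ws × All (TurningPoint p) ws × length ws ≥ k

-- All nodes in Q, and no others, receive an operation, in the common direction d.
module Growth (S : Shape) (d : Direction) (Q : Subset (Shape.size S)) where
  open Shape S

  -- The operation on u is of the second kind and subdivides the edge u v.
  Splits : Rel Node 0ℓ
  Splits u v = u ∈ Q × u ~ v × pos v ≡ pos u ⊞ unit d

  splits? : Decidable Splits
  splits? u v = (u ∈? Q) ×-dec ((u ~? v) ×-dec (pos v ≟ₚ (pos u ⊞ unit d)))

  -- inj₁ w is the existing node w; inj₂ (u , _) is the node u′ created by the
  -- operation on u.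
  GrownNode : Set
  GrownNode = Node ⊎ ∃[ u ] u ∈ Q

  data _~′_ : Rel GrownNode 0ℓ where
    kept : ∀ {u v} → u ~ v → ¬ Splits u v → ¬ Splits v u → inj₁ u ~′ inj₁ v
    uu′  : ∀ {u} (q : u ∈ Q) → inj₁ u ~′ inj₂ (u , q)
    u′u  : ∀ {u} (q : u ∈ Q) → inj₂ (u , q) ~′ inj₁ u
    u′v  : ∀ {u v} (q : u ∈ Q) → Splits u v → inj₂ (u , q) ~′ inj₁ v
    vu′  : ∀ {u v} (q : u ∈ Q) → Splits u v → inj₁ v ~′ inj₂ (u , q)

  -- Contribution of the edge a b to the displacement of the nodes beyond it,
  -- when a is the endpoint closer to the anchor: if an operation subdivides
  -- the edge, b's side is pushed away from a.  The edge has length one, so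
  -- pos b ⊟ pos a is a unit vector.
  push : Node → Node → Point
  push a b with splits? a b ⊎-dec splits? b a
  ... | yes _ = pos b ⊟ pos a
  ... | no  _ = 0ℤ , 0ℤ

  pushAlong : ∀ {u v} → Walk S u v → Point
  pushAlong     ε                 = 0ℤ , 0ℤ
  pushAlong {u} (_◅_ {j = v} _ p) = push u v ⊞ pushAlong p

  -- In a tree the path from u₀ to w is unique, so this determines disp.
  IsDisplacement : Node → (Node → Point) → Set
  IsDisplacement u₀ disp = ∀ {w} (p : Path S u₀ w) → disp w ≡ pushAlong (proj₁ p)

  pos′ : (Node → Point) → GrownNode → Point
  pos′ disp (inj₁ w)       = pos w ⊞ disp w
  pos′ disp (inj₂ (u , _)) = pos u ⊞ disp u ⊞ unit d

  -- Position at time τ ∈ [0,1] of the uniform motion from pos w to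
  -- pos w ⊞ disp w.  Endpoints are integral, so two nodes that meet at a real
  -- time also meet at a rational one.
  at : (Node → Point) → ℚ → Node → ℚ × ℚ
  at disp τ w =
    coord (proj₁ (pos w)) (proj₁ (disp w)) , coord (proj₂ (pos w)) (proj₂ (disp w))
    where
    coord : ℤ → ℤ → ℚ
    coord x δ = (x ℚ./ 1) ℚ.+ τ ℚ.* (δ ℚ./ 1)

  -- A created node emerges next to its creator and can only meet another node
  -- on the way if that node meets an existing one or they end at the same
  -- point, so only existing nodes are tracked during the motion.
  record CollisionFree (disp : Node → Point) : Set where
    field
      during : ∀ τ → 0ℚ ℚ.≤ τ → τ ℚ.≤ 1ℚ → Injective _≡_ _≡_ (at disp τ)
      end    : Injective _≡_ _≡_ (pos′ disp)

AnchoredShape : Set₁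
AnchoredShape = Σ Shape Shape.Node

record Step (A A′ : AnchoredShape) : Set where
  private
    module S  = Shape (proj₁ A)
    module S′ = Shape (proj₁ A′)
  field
    d : Direction
    Q : Subset S.size

  open Growth (proj₁ A) d Q

  field
    disp           : S.Node → Point
    isDisplacement : IsDisplacement (proj₂ A) disp
    collisionFree  : CollisionFree disp
    nodes↔         : GrownNode ↔ S′.Node

  to : GrownNode → S′.Node
  to = Inverse.to nodes↔

  field
    anchor-to : to (inj₁ (proj₂ A)) ≡ proj₂ A′
    pos-to    : ∀ a → S′.pos (to a) ≡ pos′ disp a
    ~-to      : ∀ a b → (a ~′ b) ⇔ (to a S′.~ to b)

data Process (A : AnchoredShape) : ℕ → AnchoredShape → Set₁ where
  start : Process A 0 A
  _▷_   : ∀ {t B C} → Process A t B → Step B C → Process A (suc t) C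

GrowsIn : Shape → ℕ → Shape → Set₁
GrowsIn S₀ t S = ∃[ u₀ ] ∃[ A ] (Process (S₀ , u₀) t A × proj₁ A ≅ S)

{-# OPTIONS --safe #-}

-- Count the turns of a walk as the pairs of consecutive perpendicular edges,
-- with the zero vector as direction before the first edge: being perpendicular
-- to everything, it makes the start of a nontrivial walk a turn, so that a path
-- with n turns has n + 1 turning points.  In a path of the grown shape, each
-- created node other than the last node of the path lies inside a subdivided
-- edge, whose two halves are parallel to it.  Contracting those and deleting a
-- final created node gives a path of the old shape with at most one turn less.
-- Hence after t steps every path from the anchor has at most t turns.
module Submission where

open import Data.Empty using (⊥-elim)
open import Data.Fin as Fin using (Fin)
open import Data.Fin.Subset using (Subset) renaming (_∈_ to _∈ₛ_)
open import Data.Integer as ℤ using (0ℤ)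
import Data.Integer.Properties as ℤ
open import Data.Integer.Tactic.RingSolver using (solve-∀)
open import Data.List using (List; []; _∷_; _++_; length; map)
open import Data.List.Membership.Propositional using (_∈_)
open import Data.List.Membership.Propositional.Properties using (∈-∃++; ∈-++⁺ˡ; ∈-++⁺ʳ; ∈-++⁻)
open import Data.List.Properties using (length-++; ∷-injective)
open import Data.List.Relation.Unary.All as All using (All; []; _∷_)
open import Data.List.Relation.Unary.AllPairs using ([]; _∷_)
open import Data.List.Relation.Unary.Any using (here; there)
open import Data.List.Relation.Unary.Unique.Propositional using (Unique)
open import Data.List.Relation.Unary.Unique.Propositional.Properties using (map⁺)
open import Data.Nat using (ℕ; suc; _+_; _∸_; _≤_; z≤n; s≤s)
open import Data.Nat.Properties using (+-identityʳ; +-monoʳ-≤; +-suc; ≤-reflexive; ≤-trans; ∸-monoˡ-≤; module ≤-Reasoning)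
open import Data.Product using (Σ-syntax; ∃-syntax; _×_; _,_; proj₁; proj₂)
open import Data.Sum using (inj₁; inj₂)
open import Function using (_∘_)
open import Function.Bundles using (_↔_; _⇔_; Inverse; Equivalence; Injection)
open import Function.Properties.Inverse using (↔-sym; ↔⇒↣)
open import Level using (0ℓ)
open import Relation.Binary using (Rel; Decidable)
open import Relation.Binary.Construct.Closure.ReflexiveTransitive using (Star; ε; _◅_; _◅◅_; gmap)
open import Relation.Binary.Construct.Closure.ReflexiveTransitive.Properties using (◅◅-assoc)
open import Relation.Binary.PropositionalEquality using (_≡_; refl; sym; trans; cong; cong₂; subst; subst₂)
open import Relation.Nullary using (¬_; yes; no)
open import Relation.Nullary.Decidable using (_⊎-dec_)
open import Defs

-- Counting

unique⊆⇒length≤ : ∀ {A : Set} {xs ys : List A} →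
  Unique xs → All (_∈ ys) xs → length xs ≤ length ys
unique⊆⇒length≤ [] [] = z≤n
unique⊆⇒length≤ {xs = x ∷ xs} (x∉xs ∷ xs!) (x∈ys ∷ xs⊆ys)
  -- One occurrence of `x` is cut out of `ys`; the other entries of `xs` differ from `x` and so
  -- remain in `ls ++ rs`.
  with ls , rs , refl ← ∈-∃++ x∈ys = begin
    suc (length xs)               ≤⟨ s≤s (unique⊆⇒length≤ xs! (All.zipWith remove (x∉xs , xs⊆ys))) ⟩
    suc (length (ls ++ rs))       ≡⟨ cong suc (length-++ ls) ⟩
    suc (length ls + length rs)   ≡⟨ +-suc (length ls) (length rs) ⟨
    length ls + suc (length rs)   ≡⟨ length-++ ls ⟨
    length (ls ++ x ∷ rs)         ∎
  where
  open ≤-Reasoning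
  remove : ∀ {y} → (¬ x ≡ y) × y ∈ ls ++ x ∷ rs → y ∈ ls ++ rs
  remove (x≢y , y∈) with ∈-++⁻ ls y∈
  ... | inj₁ y∈ls          = ∈-++⁺ˡ y∈ls
  ... | inj₂ (here y≡x)    = ⊥-elim (x≢y (sym y≡x))
  ... | inj₂ (there y∈rs)  = ∈-++⁺ʳ ls y∈rs

+-monoʳ-≤-suc : ∀ b {m n} → m ≤ suc n → b + m ≤ suc (b + n)
+-monoʳ-≤-suc b {n = n} m≤ = ≤-trans (+-monoʳ-≤ b m≤) (≤-reflexive (+-suc b n))

-- Directions

𝟎 : Point
𝟎 = 0ℤ , 0ℤ

infix 4 _⟂?_

_⟂?_ : Decidable _⟂_
(x , y) ⟂? (x′ , y′) = (x ℤ.* x′ ℤ.+ y ℤ.* y′) ℤ.≟ 0ℤ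

𝟎-⟂ : ∀ δ → 𝟎 ⟂ δ
𝟎-⟂ (x , y) = refl

bend# : Point → Point → ℕ
bend# δ δ′ with δ ⟂? δ′
... | yes _ = 1
... | no  _ = 0

bend#≤1 : ∀ δ δ′ → bend# δ δ′ ≤ 1
bend#≤1 δ δ′ with δ ⟂? δ′
... | yes _ = s≤s z≤n
... | no  _ = z≤n

neg : Point → Point
neg p = 𝟎 ⊟ p

bend#-unit : ∀ d → bend# (unit d) (unit d) ≡ 0
bend#-unit north = refl
bend#-unit east  = refl
bend#-unit south = refl
bend#-unit west  = refl

bend#-neg-unit : ∀ d → bend# (neg (unit d)) (neg (unit d)) ≡ 0
bend#-neg-unit north = refl
bend#-neg-unit east  = refl
bend#-neg-unit south = refl
bend#-neg-unit west  = refl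

⊞-identityʳ : ∀ p → p ⊞ 𝟎 ≡ p
⊞-identityʳ (x , y) = cong₂ _,_ (ℤ.+-identityʳ x) (ℤ.+-identityʳ y)

⊞-identityˡ : ∀ p → 𝟎 ⊞ p ≡ p
⊞-identityˡ (x , y) = cong₂ _,_ (ℤ.+-identityˡ x) (ℤ.+-identityˡ y)

⊞-assoc : ∀ p q r → (p ⊞ q) ⊞ r ≡ p ⊞ (q ⊞ r)
⊞-assoc (x , y) (x′ , y′) (x″ , y″) = cong₂ _,_ (ℤ.+-assoc x x′ x″) (ℤ.+-assoc y y′ y″)

⊞-⊟-cancel : ∀ p δ → (p ⊞ δ) ⊟ p ≡ δ
⊞-⊟-cancel (x , y) (x′ , y′) = cong₂ _,_ (lem x x′) (lem y y′)
  where
  lem : ∀ a b → a ℤ.+ b ℤ.- a ≡ b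
  lem = solve-∀

⊟-⊞-cancel : ∀ p δ → p ⊟ (p ⊞ δ) ≡ neg δ
⊟-⊞-cancel (x , y) (x′ , y′) = cong₂ _,_ (lem x x′) (lem y y′)
  where
  lem : ∀ a b → a ℤ.- (a ℤ.+ b) ≡ 0ℤ ℤ.- b
  lem = solve-∀

⊟-translate : ∀ p q c → (p ⊞ c) ⊟ (q ⊞ c) ≡ p ⊟ q
⊟-translate (x , y) (x′ , y′) (x″ , y″) = cong₂ _,_ (lem x x′ x″) (lem y y′ y″)
  where
  lem : ∀ a b c → a ℤ.+ c ℤ.- (b ℤ.+ c) ≡ a ℤ.- b
  lem = solve-∀

-- An edge from p to q moves to one from p ⊞ c to q ⊞ c′; when it is subdivided
-- by an operation on p, the created node is at p ⊞ c ⊞ e.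

kept-edge : ∀ p q c {c′ π} → π ≡ 𝟎 → c′ ≡ c ⊞ π → (q ⊞ c′) ⊟ (p ⊞ c) ≡ q ⊟ p
kept-edge (p₁ , p₂) (q₁ , q₂) (c₁ , c₂) refl refl = cong₂ _,_ (lem p₁ q₁ c₁) (lem p₂ q₂ c₂)
  where
  lem : ∀ p q c → (q ℤ.+ (c ℤ.+ 0ℤ)) ℤ.- (p ℤ.+ c) ≡ q ℤ.- p
  lem = solve-∀

forth-edge₂ : ∀ p c e {q c′ π} → q ≡ p ⊞ e → π ≡ q ⊟ p → c′ ≡ c ⊞ π →
  (q ⊞ c′) ⊟ (p ⊞ c ⊞ e) ≡ e
forth-edge₂ (p₁ , p₂) (c₁ , c₂) (e₁ , e₂) refl refl refl =
  cong₂ _,_ (lem p₁ c₁ e₁) (lem p₂ c₂ e₂)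
  where
  lem : ∀ p c e → ((p ℤ.+ e) ℤ.+ (c ℤ.+ ((p ℤ.+ e) ℤ.- p))) ℤ.- (p ℤ.+ c ℤ.+ e) ≡ e
  lem = solve-∀

back-edge₁ : ∀ p c′ e {q c π} → q ≡ p ⊞ e → π ≡ p ⊟ q → c ≡ c′ ⊞ π →
  (p ⊞ c ⊞ e) ⊟ (q ⊞ c′) ≡ neg e
back-edge₁ (p₁ , p₂) (c₁ , c₂) (e₁ , e₂) refl refl refl =
  cong₂ _,_ (lem p₁ c₁ e₁) (lem p₂ c₂ e₂)
  where
  lem : ∀ p c e → (p ℤ.+ (c ℤ.+ (p ℤ.- (p ℤ.+ e))) ℤ.+ e) ℤ.- ((p ℤ.+ e) ℤ.+ c) ≡ 0ℤ ℤ.- e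
  lem = solve-∀

-- Turns of walks

module _ {N : Set} {R : Rel N 0ℓ} where

  vertices : ∀ {u v} → Star R u v → List N
  vertices {u} ε       = u ∷ []
  vertices {u} (_ ◅ p) = u ∷ vertices p

  vertices-head : ∀ {P : N → Set} {u v} (p : Star R u v) → All P (vertices p) → P u
  vertices-head ε       (a ∷ _) = a
  vertices-head (_ ◅ _) (a ∷ _) = a

  vertices-◅◅⁻ : ∀ {P : N → Set} {u v w} (p : Star R u v) {q : Star R v w} →
    All P (vertices (p ◅◅ q)) → All P (vertices p)
  vertices-◅◅⁻ ε {q}   as       = vertices-head q as ∷ []
  vertices-◅◅⁻ (_ ◅ p) (a ∷ as) = a ∷ vertices-◅◅⁻ p as

  unique-prefix : ∀ {u v w} (p : Star R u v) {q : Star R v w} →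
    Unique (vertices (p ◅◅ q)) → Unique (vertices p)
  unique-prefix ε       _        = [] ∷ []
  unique-prefix (_ ◅ p) (a ∷ as) = vertices-◅◅⁻ p a ∷ unique-prefix p as

  module _ (pos : N → Point) where

    -- The vector `δ` is the direction in which the walk is entered.
    turns : ∀ {u v} → Point → Star R u v → ℕ
    turns     δ ε                 = 0
    turns {u} δ (_◅_ {j = v} _ p) = bend# δ (pos v ⊟ pos u) + turns (pos v ⊟ pos u) p

    -- The direction of the first edge is taken up to an equation, so that walks in two different
    -- shapes can be compared over one common vector.
    turns-◅ : ∀ {u v w} δ {δ′} (r : R u v) (p : Star R v w) → pos v ⊟ pos u ≡ δ′ →
      turns δ (r ◅ p) ≡ bend# δ δ′ + turns δ′ p
    turns-◅ δ r p refl = refl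

    turns-straight : ∀ {u v w x} δ {δ′} (r : R u v) (s : R v w) (p : Star R w x) →
      pos v ⊟ pos u ≡ δ′ → pos w ⊟ pos v ≡ δ′ → bend# δ′ δ′ ≡ 0 →
      turns δ (r ◅ s ◅ p) ≡ bend# δ δ′ + turns δ′ p
    turns-straight δ {δ′} r s p h₁ h₂ straight = trans (turns-◅ δ r (s ◅ p) h₁)
      (cong (bend# δ δ′ +_) (trans (turns-◅ δ′ s p h₂) (cong (_+ turns δ′ p) straight)))

    -- The nodes at which `turns` counts, together with the end of the walk; the end accounts for
    -- the difference of one between the two counts.
    corners : ∀ {u v} → Point → Star R u v → List N
    corners {u} δ ε = u ∷ []
    corners {u} δ (_◅_ {j = v} _ p) with δ ⟂? (pos v ⊟ pos u)
    ... | yes _ = u ∷ corners (pos v ⊟ pos u) p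
    ... | no  _ = corners (pos v ⊟ pos u) p

    length-corners : ∀ {u v} δ (p : Star R u v) → length (corners δ p) ≡ suc (turns δ p)
    length-corners δ ε = refl
    length-corners {u} δ (_◅_ {j = v} _ p) with δ ⟂? (pos v ⊟ pos u)
    ... | yes _ = cong suc (length-corners _ p)
    ... | no  _ = length-corners _ p

    corners-tail : ∀ {u v w x} δ (r : R u v) (p : Star R v w) →
      x ∈ corners (pos v ⊟ pos u) p → x ∈ corners δ (r ◅ p)
    corners-tail {u} {v} δ r p x∈ with δ ⟂? (pos v ⊟ pos u)
    ... | yes _ = there x∈
    ... | no  _ = x∈

    corners-head : ∀ {u v w} δ (r : R u v) (p : Star R v w) →
      δ ⟂ (pos v ⊟ pos u) → u ∈ corners δ (r ◅ p)
    corners-head {u} {v} δ r p δ⟂ with δ ⟂? (pos v ⊟ pos u)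
    ... | yes _ = here refl
    ... | no ¬⟂ = ⊥-elim (¬⟂ δ⟂)

    first∈corners : ∀ {u v} (p : Star R u v) → u ∈ corners 𝟎 p
    first∈corners ε                     = here refl
    first∈corners {u} (_◅_ {j = v} r p) = corners-head 𝟎 r p (𝟎-⟂ (pos v ⊟ pos u))

    last∈corners : ∀ {u v} δ (p : Star R u v) → v ∈ corners δ p
    last∈corners δ ε       = here refl
    last∈corners δ (r ◅ p) = corners-tail δ r p (last∈corners _ p)

    bend∈corners : ∀ {u v w v₁ v₂ vs} δ us (p : Star R u v) →
      vertices p ≡ us ++ v₁ ∷ w ∷ v₂ ∷ vs →
      (pos w ⊟ pos v₁) ⟂ (pos v₂ ⊟ pos w) → w ∈ corners δ p
    -- Whether the walk stops after `s` is decided first, so that `vertices` reduces and the node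
    -- after `w` is identified with `v₂`.
    bend∈corners {w = w} {v₁} δ [] (r ◅ s ◅ ε) refl b =
      corners-tail δ r (s ◅ ε) (corners-head (pos w ⊟ pos v₁) s ε b)
    bend∈corners {w = w} {v₁} δ [] (r ◅ s ◅ p@(_ ◅ _)) refl b =
      corners-tail δ r (s ◅ p) (corners-head (pos w ⊟ pos v₁) s p b)
    bend∈corners δ (_ ∷ us) (r ◅ p) eq b =
      corners-tail δ r p (bend∈corners _ us p (proj₂ (∷-injective eq)) b)
    bend∈corners δ (_ ∷ []) ε () b
    bend∈corners δ (_ ∷ _ ∷ _) ε () b

-- The start is given by an equation so that walks can be transported along
-- bijections without reindexing.
TurnsBoundedBy : {N : Set} → Rel N 0ℓ → (N → Point) → N → ℕ → Set
TurnsBoundedBy R pos u₀ n =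
  ∀ {u v} (p : Star R u v) → u ≡ u₀ → Unique (vertices p) → turns pos 𝟎 p ≤ n

-- Transport of turn bounds along bijections

module _ {N N′ : Set} {R : Rel N 0ℓ} {R′ : Rel N′ 0ℓ}
  (f : N → N′) (f-R : ∀ {u v} → R u v → R′ (f u) (f v)) where

  gmap-R : ∀ {u v} → Star R u v → Star R′ (f u) (f v)
  gmap-R = gmap {T = R} {U = R′} f f-R

  vertices-gmap : ∀ {u v} (p : Star R u v) → vertices (gmap-R p) ≡ map f (vertices p)
  vertices-gmap ε       = refl
  vertices-gmap (_ ◅ p) = cong (_ ∷_) (vertices-gmap p)

  turns-gmap : ∀ {pos : N → Point} {pos′ : N′ → Point} →
    (∀ u v → pos v ⊟ pos u ≡ pos′ (f v) ⊟ pos′ (f u)) →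
    ∀ {u v} δ (p : Star R u v) → turns pos δ p ≡ turns pos′ δ (gmap-R p)
  turns-gmap f-pos δ ε = refl
  turns-gmap {pos} f-pos {u} δ (_◅_ {j = v} r p) =
    trans (turns-◅ pos δ r p (f-pos u v)) (cong (_ +_) (turns-gmap f-pos _ p))

module _ {N N′ : Set} {R : Rel N 0ℓ} {R′ : Rel N′ 0ℓ} {pos : N → Point} {pos′ : N′ → Point}
  (ν : N ↔ N′)
  (~-to : ∀ u v → R u v ⇔ R′ (Inverse.to ν u) (Inverse.to ν v))
  (pos-to : ∀ u v → pos′ (Inverse.to ν v) ⊟ pos′ (Inverse.to ν u) ≡ pos v ⊟ pos u) where

  open Inverse ν

  -- Turns depend on positions only through differences along edges, so translations are harmless. A
  -- path is pulled back along `from`.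
  turnsBoundedBy-↔ : ∀ {u₀ n} → TurnsBoundedBy R pos u₀ n → TurnsBoundedBy R′ pos′ (to u₀) n
  turnsBoundedBy-↔ bounded p refl p! = ≤-trans
    (≤-reflexive (turns-gmap {R = R′} {R} from from-R from-pos 𝟎 p))
    (bounded (gmap-R {R = R′} {R} from from-R p) (strictlyInverseʳ _)
      (subst Unique (sym (vertices-gmap {R = R′} {R} from from-R p))
        (map⁺ (Injection.injective (↔⇒↣ (↔-sym ν))) p!)))
    where
    from-R : ∀ {x y} → R′ x y → R (from x) (from y)
    from-R {x} {y} r = Equivalence.from (~-to (from x) (from y))
      (subst₂ R′ (sym (strictlyInverseˡ x)) (sym (strictlyInverseˡ y)) r)

    from-pos : ∀ x y → pos′ y ⊟ pos′ x ≡ pos (from y) ⊟ pos (from x)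
    from-pos x y = subst₂ (λ x′ y′ → pos′ y′ ⊟ pos′ x′ ≡ _)
      (strictlyInverseˡ x) (strictlyInverseˡ y) (pos-to (from x) (from y))

-- Turning points of paths in a shape

nodes≡vertices : ∀ S {u v} (p : Walk S u v) → nodes S p ≡ vertices p
nodes≡vertices S ε       = refl
nodes≡vertices S (_ ◅ p) = cong (_ ∷_) (nodes≡vertices S p)

module _ (S : Shape) where
  open Shape S

  turningPoint∈corners : ∀ {u v w} (p : Path S u v) →
    TurningPoint S p w → w ∈ corners pos 𝟎 (proj₁ p)
  turningPoint∈corners (p , _) (first refl)            = first∈corners pos p
  turningPoint∈corners (p , _) (last refl)             = last∈corners pos 𝟎 p
  turningPoint∈corners (p , _) (bend us v₁ v₂ vs eq b) =
    bend∈corners pos 𝟎 us p (trans (sym (nodes≡vertices S p)) eq) b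

  turningPoints≤1+turns : ∀ {u v k} (p : Path S u v) →
    HasTurningPoints≥ S k p → k ≤ suc (turns pos 𝟎 (proj₁ p))
  turningPoints≤1+turns {k = k} p (ws , ws! , turning , k≤) = begin
    k                                   ≤⟨ k≤ ⟩
    length ws                           ≤⟨ unique⊆⇒length≤ ws! (All.map (turningPoint∈corners p) turning) ⟩
    length (corners pos 𝟎 (proj₁ p))    ≡⟨ length-corners pos 𝟎 (proj₁ p) ⟩
    suc (turns pos 𝟎 (proj₁ p))         ∎
    where open ≤-Reasoning

-- Contracting a path of the grown shape

module _ (S : Shape) (d : Direction) (Q : Subset (Shape.size S)) where
  open Shape S
  open Growth S d Q

  push-split : ∀ {u v} → Splits u v → push u v ≡ pos v ⊟ pos u
  push-split {u} {v} s with splits? u v ⊎-dec splits? v u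
  ... | yes _ = refl
  ... | no ¬s = ⊥-elim (¬s (inj₁ s))

  push-split-back : ∀ {u v} → Splits u v → push v u ≡ pos u ⊟ pos v
  push-split-back {u} {v} s with splits? v u ⊎-dec splits? u v
  ... | yes _ = refl
  ... | no ¬s = ⊥-elim (¬s (inj₂ s))

  push-kept : ∀ {u v} → ¬ Splits u v → ¬ Splits v u → push u v ≡ 𝟎
  push-kept {u} {v} ¬s ¬s′ with splits? u v ⊎-dec splits? v u
  ... | yes (inj₁ s) = ⊥-elim (¬s s)
  ... | yes (inj₂ s) = ⊥-elim (¬s′ s)
  ... | no _         = refl

  -- `pushAlong` unfolds at the anchor's end of a path, whereas comparing the displacements of two
  -- neighbours extends the path at its far end.
  pushAlong-snoc : ∀ {u v w} (p : Walk S u v) (r : v ~ w) →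
    pushAlong (p ◅◅ r ◅ ε) ≡ pushAlong p ⊞ push v w
  pushAlong-snoc {v = v} {w} ε r = trans (⊞-identityʳ (push v w)) (sym (⊞-identityˡ (push v w)))
  pushAlong-snoc {u} {v} {w} (_◅_ {j = j} _ p) r =
    trans (cong (push u j ⊞_) (pushAlong-snoc p r))
          (sym (⊞-assoc (push u j) (pushAlong p) (push v w)))

  infix 4 _⇝_

  -- The graph of the contraction, on which the later inductions run. `forth` and `back` cross a
  -- subdivided edge along and against `d`; `tip` drops a final created node, so the two walks may
  -- end at different nodes.
  data _⇝_ : ∀ {a b c} → Star _~′_ (inj₁ a) b → Walk S a c → Set where
    stop  : ∀ {a} → ε {x = inj₁ a} ⇝ ε
    tip   : ∀ {a x} (r : inj₁ a ~′ inj₂ x) → r ◅ ε ⇝ ε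
    keep  : ∀ {u v b c} {p′ : Star _~′_ (inj₁ v) b} {p : Walk S v c} e ¬s ¬s′ →
            p′ ⇝ p → kept {u} e ¬s ¬s′ ◅ p′ ⇝ e ◅ p
    forth : ∀ {u v b c} {p′ : Star _~′_ (inj₁ v) b} {p : Walk S v c} (i : u ∈ₛ Q) (s : Splits u v) →
            p′ ⇝ p → uu′ i ◅ u′v i s ◅ p′ ⇝ proj₁ (proj₂ s) ◅ p
    back  : ∀ {u v b c} {p′ : Star _~′_ (inj₁ u) b} {p : Walk S u c} (i : u ∈ₛ Q) (s : Splits u v) →
            p′ ⇝ p → vu′ i s ◅ u′u i ◅ p′ ⇝ ~-sym (proj₁ (proj₂ s)) ◅ p

  -- A created node has at most two neighbours, its creator and the far end of the subdivided edge.
  -- A path cannot leave it on the side where it entered.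
  contract : ∀ {a b} (p′ : Star _~′_ (inj₁ a) b) → Unique (vertices p′) →
    ∃[ c ] Σ[ p ∈ Walk S a c ] p′ ⇝ p
  contract ε _ = _ , _ , stop
  contract (kept e ¬s ¬s′ ◅ p′) (_ ∷ p′!) with contract p′ p′!
  ... | _ , _ , c = _ , _ , keep e ¬s ¬s′ c
  contract (r@(uu′ i) ◅ ε) _ = _ , _ , tip r
  contract (r@(vu′ i s) ◅ ε) _ = _ , _ , tip r
  contract (uu′ i ◅ u′v i s ◅ p′) (_ ∷ _ ∷ p′!) with contract p′ p′!
  ... | _ , _ , c = _ , _ , forth i s c
  contract (vu′ i s ◅ u′u i ◅ p′) (_ ∷ _ ∷ p′!) with contract p′ p′!
  ... | _ , _ , c = _ , _ , back i s c
  contract (uu′ i ◅ u′u i ◅ p′) ((_ ∷ a∉) ∷ _) = ⊥-elim (vertices-head p′ a∉ refl)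
  -- Both far ends lie one unit from the creator in direction `d`, hence coincide, and the path
  -- would revisit its start.
  contract (vu′ i (_ , _ , pv) ◅ u′v i (_ , _ , pv′) ◅ p′) ((_ ∷ a∉) ∷ _) =
    ⊥-elim (vertices-head p′ a∉ (cong inj₁ (pos-injective (trans pv (sym pv′)))))

  ⇝-All : ∀ {P : GrownNode → Set} {a b c} {p′ : Star _~′_ (inj₁ a) b} {p : Walk S a c} →
    p′ ⇝ p → All P (vertices p′) → All (P ∘ inj₁) (vertices p)
  ⇝-All stop           (a ∷ _)      = a ∷ []
  ⇝-All (tip _)        (a ∷ _)      = a ∷ []
  ⇝-All (keep _ _ _ c) (a ∷ as)     = a ∷ ⇝-All c as
  ⇝-All (forth _ _ c)  (a ∷ _ ∷ as) = a ∷ ⇝-All c as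
  ⇝-All (back _ _ c)   (a ∷ _ ∷ as) = a ∷ ⇝-All c as

  -- Contraction only deletes created nodes, and a repetition among the old nodes would already be
  -- one in the grown path.
  ⇝-unique : ∀ {a b c} {p′ : Star _~′_ (inj₁ a) b} {p : Walk S a c} →
    p′ ⇝ p → Unique (vertices p′) → Unique (vertices p)
  ⇝-unique stop           _                   = [] ∷ []
  ⇝-unique (tip _)        _                   = [] ∷ []
  ⇝-unique (keep _ _ _ c) (a∉ ∷ p!)           = All.map (_∘ cong inj₁) (⇝-All c a∉) ∷ ⇝-unique c p!
  ⇝-unique (forth _ _ c)  ((_ ∷ a∉) ∷ _ ∷ p!) = All.map (_∘ cong inj₁) (⇝-All c a∉) ∷ ⇝-unique c p!
  ⇝-unique (back _ _ c)   ((_ ∷ a∉) ∷ _ ∷ p!) = All.map (_∘ cong inj₁) (⇝-All c a∉) ∷ ⇝-unique c p!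

  -- Displacements and the change in turns

  module _ {u₀ : Node} {disp : Node → Point} (isDisp : IsDisplacement u₀ disp) where

    -- `IsDisplacement` speaks of whole paths from the anchor; the turn count needs the change of
    -- `disp` across each single edge.
    data Coherent : ∀ {u v} → Walk S u v → Set where
      []  : ∀ {u} → Coherent (ε {x = u})
      _∷_ : ∀ {u v w} {r : u ~ v} {p : Walk S v w} →
            disp v ≡ disp u ⊞ push u v → Coherent p → Coherent (r ◅ p)

    disp-prefix : ∀ {u v} (p : Walk S u₀ u) (q : Walk S u v) →
      Unique (vertices (p ◅◅ q)) → disp u ≡ pushAlong p
    disp-prefix p q pq! = isDisp (p , subst Unique (sym (nodes≡vertices S p)) (unique-prefix p pq!))

    -- Edges pass one by one from `q` to the part `p` already traversed. Both ends of such an edge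
    -- are reached by prefixes of one path from the anchor, which differ by that edge alone.
    coherent-suffix : ∀ {u v} (p : Walk S u₀ u) (q : Walk S u v) →
      Unique (vertices (p ◅◅ q)) → Coherent q
    coherent-suffix p ε       _   = []
    coherent-suffix {u} p (_◅_ {j = j} r q) pq! =
      trans (disp-prefix (p ◅◅ r ◅ ε) q prq!)
        (trans (pushAlong-snoc p r) (cong (_⊞ push u j) (sym (disp-prefix p (r ◅ q) pq!))))
      ∷ coherent-suffix (p ◅◅ r ◅ ε) q prq!
      where
      prq! : Unique (vertices ((p ◅◅ r ◅ ε) ◅◅ q))
      prq! = subst (Unique ∘ vertices) (sym (◅◅-assoc p (r ◅ ε) q)) pq!

    -- The extra one is spent at `tip`, whose edge has no counterpart in the old shape. Every other
    -- edge keeps its direction, and a subdivided edge gains no bend.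
    ⇝-turns : ∀ {a b c} {p′ : Star _~′_ (inj₁ a) b} {p : Walk S a c} δ →
      p′ ⇝ p → Coherent p → turns (pos′ disp) δ p′ ≤ suc (turns pos δ p)
    ⇝-turns δ stop _ = z≤n
    ⇝-turns δ (tip _) _ = ≤-trans (≤-reflexive (+-identityʳ _)) (bend#≤1 δ _)
    ⇝-turns δ (keep {u} {v} {p′ = p′} {p} e ¬s ¬s′ c) (h ∷ hs) = begin
      turns (pos′ disp) δ (kept e ¬s ¬s′ ◅ p′)   ≡⟨ turns-◅ (pos′ disp) δ (kept e ¬s ¬s′) p′ (kept-edge (pos u) (pos v) (disp u) (push-kept ¬s ¬s′) h) ⟩
      bend# δ δ′ + turns (pos′ disp) δ′ p′       ≤⟨ +-monoʳ-≤-suc (bend# δ δ′) (⇝-turns δ′ c hs) ⟩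
      suc (turns pos δ (e ◅ p))                  ∎
      where
      open ≤-Reasoning
      δ′ = pos v ⊟ pos u
    ⇝-turns δ (forth {u} {v} {p′ = p′} {p} i s@(_ , e , pv) c) (h ∷ hs) = begin
      turns (pos′ disp) δ (uu′ i ◅ u′v i s ◅ p′)
        -- The push moves `v` one further unit along `d`, so the second half of the edge also has
        -- direction `unit d`.
        ≡⟨ turns-straight (pos′ disp) δ (uu′ i) (u′v i s) p′ (⊞-⊟-cancel (pos u ⊞ disp u) δ′)
             (forth-edge₂ (pos u) (disp u) δ′ pv (push-split s) h) (bend#-unit d) ⟩
      bend# δ δ′ + turns (pos′ disp) δ′ p′
        ≤⟨ +-monoʳ-≤-suc (bend# δ δ′) (⇝-turns δ′ c hs) ⟩
      suc (bend# δ δ′ + turns pos δ′ p)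
        ≡⟨ cong suc (turns-◅ pos δ e p (trans (cong (_⊟ pos u) pv) (⊞-⊟-cancel (pos u) δ′))) ⟨
      suc (turns pos δ (e ◅ p))
        ∎
      where
      open ≤-Reasoning
      δ′ = unit d
    ⇝-turns δ (back {u} {v} {p′ = p′} {p} i s@(_ , e , pv) c) (h ∷ hs) = begin
      turns (pos′ disp) δ (vu′ i s ◅ u′u i ◅ p′)
        -- Here `v` is nearer to the anchor, so `u` is the node pushed, opposite to `d`.
        ≡⟨ turns-straight (pos′ disp) δ (vu′ i s) (u′u i) p′
             (back-edge₁ (pos u) (disp v) (unit d) pv (push-split-back s) h)
             (⊟-⊞-cancel (pos u ⊞ disp u) (unit d)) (bend#-neg-unit d) ⟩
      bend# δ δ′ + turns (pos′ disp) δ′ p′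
        ≤⟨ +-monoʳ-≤-suc (bend# δ δ′) (⇝-turns δ′ c hs) ⟩
      suc (bend# δ δ′ + turns pos δ′ p)
        ≡⟨ cong suc (turns-◅ pos δ (~-sym e) p (trans (cong (pos u ⊟_) pv) (⊟-⊞-cancel (pos u) (unit d)))) ⟨
      suc (turns pos δ (~-sym e ◅ p))
        ∎
      where
      open ≤-Reasoning
      δ′ = neg (unit d)

    turnsBoundedBy-grow : ∀ {n} → TurnsBoundedBy _~_ pos u₀ n →
      TurnsBoundedBy _~′_ (pos′ disp) (inj₁ u₀) (suc n)
    turnsBoundedBy-grow bounded p′ refl p′! with contract p′ p′!
    -- The contracted path starts at the anchor, so the prefix leading to it is empty.
    ... | _ , p , c = ≤-trans (⇝-turns 𝟎 c (coherent-suffix ε p p!)) (s≤s (bounded p refl p!))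
      where p! = ⇝-unique c p′!

-- Induction over the growth process

AnchorTurnsBoundedBy : AnchoredShape → ℕ → Set
AnchorTurnsBoundedBy (S , u₀) = TurnsBoundedBy (Shape._~_ S) (Shape.pos S) u₀

step-turns : ∀ {A B n} → Step A B → AnchorTurnsBoundedBy A n → AnchorTurnsBoundedBy B (suc n)
step-turns {S , _} {S′ , _} {n} step bounded =
  subst (λ a → TurnsBoundedBy (Shape._~_ S′) (Shape.pos S′) a (suc n)) anchor-to
    (turnsBoundedBy-↔ nodes↔ ~-to
      (λ a b → cong₂ _⊟_ (pos-to b) (pos-to a))
      (turnsBoundedBy-grow S d Q isDisplacement bounded))
  where open Step step

process-turns : ∀ {A B t} → AnchorTurnsBoundedBy A 0 → Process A t B → AnchorTurnsBoundedBy B t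
process-turns bounded start          = bounded
process-turns bounded (process ▷ st) = step-turns st (process-turns bounded process)

Fin1-irrelevant : ∀ {n} → n ≡ 1 → (i j : Fin n) → i ≡ j
Fin1-irrelevant refl Fin.zero Fin.zero = refl

singleton-turns : ∀ S u₀ → Shape.size S ≡ 1 → AnchorTurnsBoundedBy (S , u₀) 0
singleton-turns S u₀ size≡1 ε       _ _        = z≤n
singleton-turns S u₀ size≡1 (_ ◅ p) _ (u∉ ∷ _) =
  ⊥-elim (vertices-head p u∉ (Fin1-irrelevant size≡1 _ _))

theorem3p4 : (T : Shape) → IsTree T → (k : ℕ) → 1 ≤ k →
    (∀ u₀ → ∃[ w ] (Leaf T u₀ w × (Σ[ p ∈ Path T u₀ w ] HasTurningPoints≥ T k p))) →
    (S₀ : Shape) → Shape.size S₀ ≡ 1 →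
    (t : ℕ) → GrowsIn S₀ t T → k ∸ 1 ≤ t
theorem3p4 T _ k _ bent S₀ size≡1 t (u₀ , (S , a) , process , S≅T)
  -- The bound covers only paths from the anchor, so the image of the final anchor is chosen as
  -- root.
  with w , _ , p , turning ← bent (_≅_.to S≅T a) =
  ≤-trans (∸-monoˡ-≤ 1 (turningPoints≤1+turns T p turning))
    (bounded (proj₁ p) refl (subst Unique (nodes≡vertices T (proj₁ p)) (proj₂ p)))
  where
  open _≅_ S≅T
  open Shape
  bounded : AnchorTurnsBoundedBy (T , to a) t
  bounded = turnsBoundedBy-↔ nodes↔ ~-to
    (λ u v → trans (cong₂ _⊟_ (pos-to v) (pos-to u)) (⊟-translate (pos S v) (pos S u) translation))
    (process-turns (singleton-turns S₀ u₀ size≡1) process)
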